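{- Let $\mathbf X,\mathbf Y,\mathbf U,\mathbf V$ be represented spaces such that $\mathbf X$ has a total precomplete representation. Let $f:\mathbf X\rightrightarrows\mathbf Y$ and $g:\mathbf U\rightrightarrows\mathbf V$ be multivalued functions such that there exists a computable multivalued function $e:\mathbf U\times\mathcal M(\mathbf V,\mathbf Y)\rightrightarrows\mathbf X$ with the property that whenever $x\in e(u,k)$ and $v\in g(u)$, then $k(v)\nsubseteq f(x)$. Then $f\not\le_{\mathrm W}g$.
   Context: A represented space $\mathbf X$ is a set $X$ with a partial surjection (representation) $\delta_{\mathbf X}:\subseteq\mathbb N^{\mathbb N}\to X$ (a $p$ with $\delta_{\mathbf X}(p)=x$ is a name of $x$). A realizer of a (partial) multivalued function $f:\subseteq\mathbf X\rightrightarrows\mathbf Y$ is a partial $F:\subseteq\mathbb N^{\mathbb N}\to\mathbb N^{\mathbb N}$ with $\delta_{\mathbf Y}(F(p))\in f(\delta_{\mathbf X}(p))$ for all names $p$ of points of $\mathrm{dom}(f)$; write $F\vdash f$. $f$ is computable if it has a computable realizer. Weihrauch reducibility: $f\le_{\mathrm W}g$ iff there are computable $H,K:\subseteq\mathbb N^{\mathbb N}\to\mathbb N^{\mathbb N}$ such that $(p\mapsto K\langle p,GH(p)\rangle)\vdash f$ for every $G\vdash g$. A representation $\delta$ of $\mathbf X$ is precomplete if every computable partial $h:\subseteq 2^\omega\to\mathbf X$ extends to a computable total $h':2^\omega\to\mathbf X$. A representation is total if it is defined on every sequence. $\mathcal M(\mathbf V,\mathbf Y)$ is the represented space of strongly continuous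 (partial) multivalued functions from $\mathbf V$ to $\mathbf Y$: each partial continuous function $F$ on names induces a minimal strongly continuous multivalued function $k$ of which it is a realizer, namely $\mathrm{dom}(k)=\{v: \delta_{\mathbf Y}(F(p))\text{ is defined for all names }p\text{ of }v\}$ and $k(v)=\{\delta_{\mathbf Y}(F(p)): p\text{ a name of }v\}$; conversely every strongly continuous multivalued function is given by a continuous partial realizer. A name of $k$ is a standard code (as in the UTM theorem) of such a partial continuous $F$. -}

module Defs where

open import Data.Bool.Base using (Bool; true; false)
open import Data.Nat.Base using (ℕ; zero; suc; _+_; _<_)
open import Data.Nat.Properties using (+-identityʳ; +-suc; suc-injective; <-cmp)
open import Data.Product.Base using (Σ-syntax; ∃; ∃₂; ∃-syntax; _×_; _,_; proj₁; proj₂)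
open import Data.Product.Properties using (,-injective)
open import Data.Product.Relation.Binary.Pointwise.NonDependent using (×-setoid)
open import Function.Base using (_∘_)
open import Level using (Level; 0ℓ; _⊔_) renaming (suc to lsuc)
open import Relation.Binary.Bundles using (Setoid)
open import Relation.Binary.Definitions using (tri<; tri≈; tri>)
open import Relation.Binary.PropositionalEquality
  using (_≡_; refl; sym; trans; cong; cong₂; subst; _≗_; _→-setoid_)
open import Relation.Unary using (Pred; _∈_; _⊆_; _≐_)
open import Relation.Unary.Properties using (≐-refl; ≐-sym; ≐-trans)

private variable
  a b c : Level

Baire : Set
Baire = ℕ → ℕ

tail : Baire → Baire
tail p = p ∘ suc

-- ⟨ p , q ⟩ = p(0) q(0) p(1) q(1) …
⟨_,_⟩ : Baire → Baire → Baire
⟨ p , q ⟩ zero    = p zero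
⟨ p , q ⟩ (suc n) = ⟨ q , tail p ⟩ n

⟨⟩-cong : ∀ {p p′ q q′} → p ≗ p′ → q ≗ q′ → ⟨ p , q ⟩ ≗ ⟨ p′ , q′ ⟩
⟨⟩-cong p≗ q≗ zero    = p≗ zero
⟨⟩-cong p≗ q≗ (suc n) = ⟨⟩-cong q≗ (p≗ ∘ suc) n

⟨⟩-injective : ∀ {p p′ q q′} → ⟨ p , q ⟩ ≗ ⟨ p′ , q′ ⟩ → p ≗ p′ × q ≗ q′
⟨⟩-injective eq = proj₁ ∘ both eq , proj₂ ∘ both eq
  where
  both : ∀ {p p′ q q′} → ⟨ p , q ⟩ ≗ ⟨ p′ , q′ ⟩ → ∀ n → p n ≡ p′ n × q n ≡ q′ n
  both eq zero    = eq 0 , eq 1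
  both eq (suc n) = both (eq ∘ suc ∘ suc) n

-- Cantor's pairing function ℕ × ℕ → ℕ; unpair walks along the antidiagonals.

triangle : ℕ → ℕ
triangle zero    = zero
triangle (suc n) = suc (triangle n + n)

infix 8 _∙_
_∙_ : ℕ → ℕ → ℕ
m ∙ n = triangle (m + n) + n

next : ℕ × ℕ → ℕ × ℕ
next (zero  , n) = suc n , zero
next (suc m , n) = m , suc n

unpair : ℕ → ℕ × ℕ
unpair zero    = zero , zero
unpair (suc n) = next (unpair n)

π₁ π₂ : ℕ → ℕ
π₁ = proj₁ ∘ unpair
π₂ = proj₂ ∘ unpair

unpair-∙ : ∀ m n → unpair (m ∙ n) ≡ (m , n)
unpair-∙ m n = go (m + n) m n refl
  where
  go : ∀ s m n → m + n ≡ s → unpair (triangle s + n) ≡ (m , n)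
  go zero    zero    zero    _  = refl
  go (suc s) (suc m) zero    eq
    rewrite +-identityʳ (triangle s + s) | +-identityʳ m
          | go s zero s refl | suc-injective eq = refl
  go s m (suc n) eq = trans (cong unpair (+-suc (triangle s) n))
    (cong next (go s (suc m) n (trans (sym (+-suc m n)) eq)))

∙-injective : ∀ {m n m′ n′} → m ∙ n ≡ m′ ∙ n′ → m ≡ m′ × n ≡ n′
∙-injective {m} {n} {m′} {n′} eq =
  ,-injective (trans (sym (unpair-∙ m n)) (trans (cong unpair eq) (unpair-∙ m′ n′)))

-- Programs for the functions ℕ ⇀ ℕ that are partial recursive relative to an
-- oracle p : Baire.

data Code : Set where
  zero succ fst snd oracle : Code
  pair comp prec           : Code → Code → Code
  mu                       : Code → Code

infix 4 _⊢_·_⇓_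

mutual
  -- p ⊢ e · n ⇓ m : with oracle p, program e halts on input n with output m.
  data _⊢_·_⇓_ (p : Baire) : Code → ℕ → ℕ → Set where
    zero   : ∀ {n} → p ⊢ zero · n ⇓ 0
    succ   : ∀ {n} → p ⊢ succ · n ⇓ suc n
    fst    : ∀ {n} → p ⊢ fst · n ⇓ π₁ n
    snd    : ∀ {n} → p ⊢ snd · n ⇓ π₂ n
    oracle : ∀ {n} → p ⊢ oracle · n ⇓ p n
    pair   : ∀ {d e n k m} → p ⊢ d · n ⇓ k → p ⊢ e · n ⇓ m → p ⊢ pair d e · n ⇓ k ∙ m
    comp   : ∀ {d e n k m} → p ⊢ e · n ⇓ k → p ⊢ d · k ⇓ m → p ⊢ comp d e · n ⇓ m
    prec   : ∀ {d e n m} → Iterate p d e (π₁ n) (π₂ n) m → p ⊢ prec d e · n ⇓ m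
    mu     : ∀ {e n m} → p ⊢ e · n ∙ m ⇓ 0 →
             (∀ {j} → j < m → ∃[ i ] p ⊢ e · n ∙ j ⇓ suc i) →
             p ⊢ mu e · n ⇓ m

  -- Primitive recursion: r(x, 0) = d(x) and r(x, k+1) = e(x, k, r(x, k)).
  data Iterate (p : Baire) (d e : Code) (x : ℕ) : ℕ → ℕ → Set where
    base : ∀ {m} → p ⊢ d · x ⇓ m → Iterate p d e x zero m
    step : ∀ {k i m} → Iterate p d e x k i → p ⊢ e · x ∙ (k ∙ i) ⇓ m →
           Iterate p d e x (suc k) m

mutual
  ⇓-functional : ∀ {p q e n m m′} → p ≗ q →
                 p ⊢ e · n ⇓ m → q ⊢ e · n ⇓ m′ → m ≡ m′
  ⇓-functional eq zero   zero   = refl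
  ⇓-functional eq succ   succ   = refl
  ⇓-functional eq fst    fst    = refl
  ⇓-functional eq snd    snd    = refl
  ⇓-functional eq oracle oracle = eq _
  ⇓-functional eq (pair s t) (pair s′ t′) =
    cong₂ _∙_ (⇓-functional eq s s′) (⇓-functional eq t t′)
  ⇓-functional eq (comp s t) (comp s′ t′) with refl ← ⇓-functional eq s s′ =
    ⇓-functional eq t t′
  ⇓-functional eq (prec s) (prec s′) = Iterate-functional eq s s′
  ⇓-functional eq (mu {m = m} s t) (mu {m = m′} s′ t′) with <-cmp m m′
  ... | tri≈ _ m≡m′ _ = m≡m′
  ... | tri< m<m′ _ _ with () ← ⇓-functional eq s (proj₂ (t′ m<m′))
  ... | tri> _ _ m′<m with () ← ⇓-functional eq (proj₂ (t m′<m)) s′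

  Iterate-functional : ∀ {p q d e x k m m′} → p ≗ q →
                       Iterate p d e x k m → Iterate q d e x k m′ → m ≡ m′
  Iterate-functional eq (base s)   (base s′)    = ⇓-functional eq s s′
  Iterate-functional eq (step s t) (step s′ t′) with refl ← Iterate-functional eq s s′ =
    ⇓-functional eq t t′

mutual
  ⇓-resp : ∀ {p q e n m} → p ≗ q → p ⊢ e · n ⇓ m → q ⊢ e · n ⇓ m
  ⇓-resp eq zero   = zero
  ⇓-resp eq succ   = succ
  ⇓-resp eq fst    = fst
  ⇓-resp eq snd    = snd
  ⇓-resp {q = q} eq (oracle {n}) = subst (q ⊢ oracle · n ⇓_) (sym (eq n)) oracle
  ⇓-resp eq (pair s t) = pair (⇓-resp eq s) (⇓-resp eq t)
  ⇓-resp eq (comp s t) = comp (⇓-resp eq s) (⇓-resp eq t)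
  ⇓-resp eq (prec s)   = prec (Iterate-resp eq s)
  ⇓-resp eq (mu s t)   = mu (⇓-resp eq s) λ j<m → let i , r = t j<m in i , ⇓-resp eq r

  Iterate-resp : ∀ {p q d e x k m} → p ≗ q → Iterate p d e x k m → Iterate q d e x k m
  Iterate-resp eq (base s)   = base (⇓-resp eq s)
  Iterate-resp eq (step s t) = step (Iterate-resp eq s) (⇓-resp eq t)

gödel : Code → ℕ
gödel zero       = 0 ∙ 0
gödel succ       = 1 ∙ 0
gödel fst        = 2 ∙ 0
gödel snd        = 3 ∙ 0
gödel oracle     = 4 ∙ 0
gödel (pair d e) = 5 ∙ (gödel d ∙ gödel e)
gödel (comp d e) = 6 ∙ (gödel d ∙ gödel e)
gödel (prec d e) = 7 ∙ (gödel d ∙ gödel e)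
gödel (mu e)     = 8 ∙ gödel e

gödel-injective : ∀ {d e} → gödel d ≡ gödel e → d ≡ e
gödel-injective {d} {e} = go d e
  where
  tag args : Code → ℕ
  tag zero       = 0
  tag succ       = 1
  tag fst        = 2
  tag snd        = 3
  tag oracle     = 4
  tag (pair _ _) = 5
  tag (comp _ _) = 6
  tag (prec _ _) = 7
  tag (mu _)     = 8
  args (pair d e) = gödel d ∙ gödel e
  args (comp d e) = gödel d ∙ gödel e
  args (prec d e) = gödel d ∙ gödel e
  args (mu e)     = gödel e
  args _          = 0

  split : ∀ e → gödel e ≡ tag e ∙ args e
  split zero       = refl
  split succ       = refl
  split fst        = refl
  split snd        = refl
  split oracle     = refl
  split (pair _ _) = refl
  split (comp _ _) = refl
  split (prec _ _) = refl
  split (mu _)     = refl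

  go : ∀ d e → gödel d ≡ gödel e → d ≡ e
  same : ∀ d e → tag d ≡ tag e → args d ≡ args e → d ≡ e

  go d e eq =
    let tags , argss = ∙-injective (trans (sym (split d)) (trans eq (split e)))
    in same d e tags argss

  same zero       zero         _ _  = refl
  same succ       succ         _ _  = refl
  same fst        fst          _ _  = refl
  same snd        snd          _ _  = refl
  same oracle     oracle       _ _  = refl
  same (pair d e) (pair d′ e′) _ eq =
    let l , r = ∙-injective eq in cong₂ pair (go d d′ l) (go e e′ r)
  same (comp d e) (comp d′ e′) _ eq =
    let l , r = ∙-injective eq in cong₂ comp (go d d′ l) (go e e′ r)
  same (prec d e) (prec d′ e′) _ eq =
    let l , r = ∙-injective eq in cong₂ prec (go d d′ l) (go e e′ r)
  same (mu e)     (mu e′)      _ eq = cong mu (go e e′ eq)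

-- x ∈ δ p : p is a name of x.

record RepresentedSpace (c : Level) : Set (lsuc (c ⊔ lsuc 0ℓ)) where
  field
    setoid : Setoid c 0ℓ
  open Setoid setoid public using (Carrier; _≈_)
  field
    δ            : Baire → Pred Carrier 0ℓ
    δ-resp       : ∀ {p p′ x x′} → p ≗ p′ → x ≈ x′ → x ∈ δ p → x′ ∈ δ p′
    δ-functional : ∀ {p x x′} → x ∈ δ p → x′ ∈ δ p → x ≈ x′
    δ-surjective : ∀ x → ∃[ p ] x ∈ δ p

open RepresentedSpace using (Carrier; δ)

ℕᴺ : RepresentedSpace 0ℓ
ℕᴺ = record
  { setoid       = ℕ →-setoid ℕ
  ; δ            = _≗_
  ; δ-resp       = λ p≗ x≗ eq n → trans (sym (p≗ n)) (trans (eq n) (x≗ n))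
  ; δ-functional = λ eq eq′ n → trans (sym (eq n)) (eq′ n)
  ; δ-surjective = λ p → p , λ _ → refl
  }

bit : Bool → ℕ
bit false = 0
bit true  = 1

bit-injective : ∀ {x y} → bit x ≡ bit y → x ≡ y
bit-injective {false} {false} _ = refl
bit-injective {true}  {true}  _ = refl

2^ω : RepresentedSpace 0ℓ
2^ω = record
  { setoid       = ℕ →-setoid Bool
  ; δ            = λ p x → p ≗ bit ∘ x
  ; δ-resp       = λ p≗ x≗ eq n → trans (sym (p≗ n)) (trans (eq n) (cong bit (x≗ n)))
  ; δ-functional = λ eq eq′ n → bit-injective (trans (sym (eq n)) (eq′ n))
  ; δ-surjective = λ x → bit ∘ x , λ _ → refl
  }

infixr 4 _×ʳ_
_×ʳ_ : RepresentedSpace a → RepresentedSpace b → RepresentedSpace (a ⊔ b)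
X ×ʳ Y = record
  { setoid = ×-setoid X.setoid Y.setoid
  ; δ      = λ r (x , y) → ∃₂ λ p q → r ≗ ⟨ p , q ⟩ × x ∈ X.δ p × y ∈ Y.δ q
  ; δ-resp = λ r≗ (x≈ , y≈) (p , q , eq , x∈ , y∈) →
      p , q , (λ n → trans (sym (r≗ n)) (eq n)) ,
      X.δ-resp (λ _ → refl) x≈ x∈ , Y.δ-resp (λ _ → refl) y≈ y∈
  ; δ-functional = λ (p , q , eq , x∈ , y∈) (p′ , q′ , eq′ , x′∈ , y′∈) →
      let p≗ , q≗ = ⟨⟩-injective (λ n → trans (sym (eq n)) (eq′ n))
      in X.δ-functional (X.δ-resp p≗ X.refl x∈) x′∈ ,
         Y.δ-functional (Y.δ-resp q≗ Y.refl y∈) y′∈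
  ; δ-surjective = λ (x , y) →
      let p , x∈ = X.δ-surjective x
          q , y∈ = Y.δ-surjective y
      in ⟨ p , q ⟩ , p , q , (λ _ → refl) , x∈ , y∈
  }
  where
  module X where
    open RepresentedSpace X public
    open Setoid setoid public using (refl)
  module Y where
    open RepresentedSpace Y public
    open Setoid setoid public using (refl)

-- Partial multivalued functions: f at x is the set f(x), which is empty
-- exactly when x ∉ dom(f).

infix 3 _⇉_ _⇀_

record _⇉_ (X : RepresentedSpace a) (Y : RepresentedSpace b) : Set (a ⊔ b ⊔ lsuc 0ℓ) where
  private
    module X = RepresentedSpace X
    module Y = RepresentedSpace Y
  infix 6 _at_
  field
    _at_    : X.Carrier → Pred Y.Carrier 0ℓ
    at-resp : ∀ {x x′ y y′} → x X.≈ x′ → y Y.≈ y′ → y ∈ _at_ x → y′ ∈ _at_ x′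

open _⇉_ public using (_at_)

dom : {X : RepresentedSpace a} {Y : RepresentedSpace b} → (X ⇉ Y) → Pred (Carrier X) b
dom f x = ∃[ y ] y ∈ f at x

Total : {X : RepresentedSpace a} {Y : RepresentedSpace b} → (X ⇉ Y) → Set (a ⊔ b)
Total f = ∀ x → x ∈ dom f

record _⇀_ (X : RepresentedSpace a) (Y : RepresentedSpace b) : Set (a ⊔ b ⊔ lsuc 0ℓ) where
  field
    graph      : X ⇉ Y
    functional : ∀ {x y y′} → y ∈ graph at x → y′ ∈ graph at x →
                 RepresentedSpace._≈_ Y y y′

open _⇀_ public using (graph)

⟦_⟧ : Code → (ℕᴺ ⇀ ℕᴺ)
⟦ e ⟧ = record
  { graph = record
    { _at_    = λ p q → ∀ n → p ⊢ e · n ⇓ q n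
    ; at-resp = λ {p} {p′} p≗ q≗ h n → subst (p′ ⊢ e · n ⇓_) (q≗ n) (⇓-resp p≗ (h n))
    }
  ; functional = λ h h′ n → ⇓-functional (λ _ → refl) (h n) (h′ n)
  }

infix 4 _⊩_
_⊩_ : {X : RepresentedSpace a} {Y : RepresentedSpace b} → (ℕᴺ ⇀ ℕᴺ) → (X ⇉ Y) → Set (a ⊔ b)
_⊩_ {X = X} {Y = Y} F f =
  ∀ {p x} → x ∈ δ X p → x ∈ dom f →
  ∃[ q ] q ∈ graph F at p × ∃[ y ] y ∈ δ Y q × y ∈ f at x

Computable : {X : RepresentedSpace a} {Y : RepresentedSpace b} → (X ⇉ Y) → Set (a ⊔ b)
Computable f = ∃[ e ] ⟦ e ⟧ ⊩ f

-- p ↦ K⟨p, G(H(p))⟩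
sandwich : (K G H : ℕᴺ ⇀ ℕᴺ) → ℕᴺ ⇀ ℕᴺ
sandwich K G H = record
  { graph = record
    { _at_    = λ p t → ∃₂ λ r s →
                  r ∈ graph H at p × s ∈ graph G at r × t ∈ graph K at ⟨ p , s ⟩
    ; at-resp = λ p≗ t≗ (r , s , Hr , Gs , Kt) →
        r , s , H.at-resp p≗ (λ _ → refl) Hr , Gs ,
        K.at-resp (⟨⟩-cong p≗ (λ _ → refl)) t≗ Kt
    }
  ; functional = λ (r , s , Hr , Gs , Kt) (r′ , s′ , Hr′ , Gs′ , Kt′) →
      let r≗ = _⇀_.functional H Hr Hr′
          s≗ = _⇀_.functional G (G.at-resp r≗ (λ _ → refl) Gs) Gs′
      in _⇀_.functional K (K.at-resp (⟨⟩-cong (λ _ → refl) s≗) (λ _ → refl) Kt) Kt′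
  }
  where
  module H = _⇉_ (graph H)
  module G = _⇉_ (graph G)
  module K = _⇉_ (graph K)

infix 4 _≤W_
_≤W_ : {X Y U V : RepresentedSpace 0ℓ} → (X ⇉ Y) → (U ⇉ V) → Set (lsuc 0ℓ)
f ≤W g = ∃₂ λ H K → ∀ (G : ℕᴺ ⇀ ℕᴺ) → G ⊩ g → sandwich ⟦ K ⟧ G ⟦ H ⟧ ⊩ f

TotalRepresentation : RepresentedSpace c → Set c
TotalRepresentation X = ∀ p → ∃[ x ] x ∈ δ X p

Precomplete : RepresentedSpace c → Set (c ⊔ lsuc 0ℓ)
Precomplete X =
  (h : 2^ω ⇀ X) → Computable (graph h) →
  Σ[ h′ ∈ (2^ω ⇀ X) ] Total (graph h′) × Computable (graph h′) ×
                      (∀ b → graph h at b ⊆ graph h′ at b)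

-- The partial continuous function with standard code p: p(0) is the index of a
-- program, which is run with access to the parameter p(1) p(2) … and the input.
η : Baire → (ℕᴺ ⇀ ℕᴺ)
η p = record
  { graph = record
    { _at_    = λ q r → ∃[ e ] p 0 ≡ gödel e × r ∈ graph ⟦ e ⟧ at ⟨ tail p , q ⟩
    ; at-resp = λ q≗ r≗ (e , eq , h) →
        e , eq , _⇉_.at-resp (graph ⟦ e ⟧) (⟨⟩-cong (λ _ → refl) q≗) r≗ h
    }
  ; functional = λ {q} (e , eq , h) (e′ , eq′ , h′) →
      _⇀_.functional ⟦ e ⟧ {⟨ tail p , q ⟩} h
        (subst (λ d → _ ∈ graph ⟦ d ⟧ at ⟨ tail p , q ⟩)
               (gödel-injective (trans (sym eq′) eq)) h′)
  }

η-cong : ∀ {p p′} → p ≗ p′ → ∀ q → graph (η p) at q ⊆ graph (η p′) at q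
η-cong p≗ q (e , eq , h) =
  e , trans (sym (p≗ 0)) eq ,
  _⇉_.at-resp (graph ⟦ e ⟧) (⟨⟩-cong (p≗ ∘ suc) (λ _ → refl)) (λ _ → refl) h

module _ (V Y : RepresentedSpace 0ℓ) where
  private
    module V = RepresentedSpace V
    module Y = RepresentedSpace Y
    module Vˢ = Setoid V.setoid
    module Yˢ = Setoid Y.setoid

  -- The minimal multivalued function of which F is a realizer.
  induced : (ℕᴺ ⇀ ℕᴺ) → (V ⇉ Y)
  induced F = record
    { _at_    = λ v y →
        (∀ p → v ∈ V.δ p → ∃[ q ] q ∈ graph F at p × ∃[ z ] z ∈ Y.δ q) ×
        (∃[ p ] v ∈ V.δ p × ∃[ q ] q ∈ graph F at p × y ∈ Y.δ q)
    ; at-resp = λ v≈ y≈ (def , p , v∈ , q , Fq , y∈) →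
        (λ p v′∈ → def p (V.δ-resp (λ _ → refl) (Vˢ.sym v≈) v′∈)) ,
        p , V.δ-resp (λ _ → refl) v≈ v∈ , q , Fq , Y.δ-resp (λ _ → refl) y≈ y∈
    }

  induced-mono : ∀ {F G} → (∀ q → graph F at q ⊆ graph G at q) →
                 ∀ v → induced F at v ⊆ induced G at v
  induced-mono F⊆G v (def , p , v∈ , q , Fq , y∈) =
    (λ p v∈ → let q , Fq , z = def p v∈ in q , F⊆G p Fq , z) ,
    p , v∈ , q , F⊆G p Fq , y∈

  Codes : Baire → Pred (V ⇉ Y) 0ℓ
  Codes p k = ∀ v → k at v ≐ induced (η p) at v

  StronglyContinuous : Pred (V ⇉ Y) 0ℓ
  StronglyContinuous k = ∃[ p ] Codes p k

  -- Multivalued functions are identified when they have the same values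
  -- everywhere, not when they have the same code.
  𝓜 : RepresentedSpace (lsuc 0ℓ)
  𝓜 = record
    { setoid = record
      { Carrier       = ∃ StronglyContinuous
      ; _≈_           = λ (k , _) (k′ , _) → ∀ v → k at v ≐ k′ at v
      ; isEquivalence = record
        { refl  = λ _ → ≐-refl
        ; sym   = λ eq v → ≐-sym (eq v)
        ; trans = λ eq eq′ v → ≐-trans (eq v) (eq′ v)
        }
      }
    ; δ            = λ p (k , _) → Codes p k
    ; δ-resp       = λ {p} {p′} p≗ k≈ k∈ v → ≐-trans (≐-sym (k≈ v)) (≐-trans (k∈ v)
        ( induced-mono {η p} {η p′} (η-cong p≗) v
        , induced-mono {η p′} {η p} (η-cong (λ n → sym (p≗ n))) v ))
    ; δ-functional = λ k∈ k′∈ v → ≐-trans (k∈ v) (≐-sym (k′∈ v))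
    ; δ-surjective = λ (k , p , k∈) → p , k∈
    }

{-# OPTIONS --safe #-}

-- Suppose f ≤W g via H and K.  It suffices to find a name p of some x with
-- x ∈ e(u, k), where H(p) names u and k is induced by q ↦ K⟨p, q⟩: since any
-- name of any v ∈ g(u) is the answer of some realizer of g at H(p), the
-- reduction then gives v ∈ dom k and k(v) ⊆ f(x).
-- Such a p is a fixed point, obtained from precompleteness as in the recursion
-- theorem.  No universal program is needed: a point of Cantor space need not
-- be computable, so it can tabulate which finite prefixes of the oracle force
-- which outputs of a given program d, and a fixed program evaluates d on that
-- very oracle by searching the table.

module Submission where

open import Defs
open import Axiom.ExcludedMiddle using (ExcludedMiddle)
open import Axiom.Extensionality.Propositional using (Extensionality)
open import Data.Bool.Base using (Bool)
open import Data.Empty using (⊥)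
open import Data.Nat.Base using (ℕ; zero; suc; _<_; _≤_; _⊔_; s<s⁻¹)
open import Data.Nat.Properties
  using (+-identityʳ; +-suc; m<1+n⇒m<n∨m≡n; <-≤-trans; n<1+n; m<n⇒m<1+n; m≤m⊔n; m≤n⊔m)
open import Data.Product.Base using (Σ-syntax; ∃-syntax; _×_; _,_; proj₁; proj₂)
open import Data.Sum.Base using (inj₁; inj₂)
open import Function.Base using (_∘_; case_of_)
open import Level using (0ℓ)
open import Relation.Binary.Bundles using (Setoid)
open import Relation.Binary.PropositionalEquality
  using (_≡_; refl; sym; trans; cong; subst; _≗_)
open import Relation.Nullary.Decidable.Core using (Dec; yes; no; does)
open import Relation.Nullary.Negation.Core using (¬_; contradiction)
open import Relation.Unary using (Pred; _∈_; _⊆_)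
open import Relation.Unary.Properties using (≐-refl)

private variable
  p q : Baire
  d e : Code
  i j k m n : ℕ

-- Continuity of oracle computations

_≗[_]_ : Baire → ℕ → Baire → Set
p ≗[ k ] q = ∀ {i} → i < k → p i ≡ q i

≗[]-antitone : j ≤ k → p ≗[ k ] q → p ≗[ j ] q
≗[]-antitone j≤k eq i<j = eq (<-≤-trans i<j j≤k)

Local : Baire → (Baire → Set) → Set
Local p P = ∃[ k ] ∀ {q} → p ≗[ k ] q → P q

Local-× : {P Q : Baire → Set} → Local p P → Local p Q → Local p (λ q → P q × Q q)
Local-× (j , f) (k , g) = j ⊔ k , λ eq →
  f (≗[]-antitone (m≤m⊔n j k) eq) , g (≗[]-antitone (m≤n⊔m j k) eq)

Local-∀< : {P : ℕ → Baire → Set} (m : ℕ) → (∀ {j} → j < m → Local p (P j)) →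
           Local p (λ q → ∀ {j} → j < m → P j q)
Local-∀< zero    f = 0 , λ _ ()
Local-∀< (suc m) f with Local-× (Local-∀< m (f ∘ m<n⇒m<1+n)) (f (n<1+n m))
... | k , g = k , λ eq j<1+m → case m<1+n⇒m<n∨m≡n j<1+m of λ where
  (inj₁ j<m)  → proj₁ (g eq) j<m
  (inj₂ refl) → proj₂ (g eq)

mutual
  -- A halting derivation consults only finitely many oracle entries; in the `mu` case the failed
  -- trials are finite in number too.
  ⇓-local : p ⊢ e · n ⇓ m → Local p (λ q → q ⊢ e · n ⇓ m)
  ⇓-local zero   = 0 , λ _ → zero
  ⇓-local succ   = 0 , λ _ → succ
  ⇓-local fst    = 0 , λ _ → fst
  ⇓-local snd    = 0 , λ _ → snd
  ⇓-local (oracle {n}) = suc n , λ {q} eq →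
    subst (q ⊢ oracle · n ⇓_) (sym (eq (n<1+n n))) oracle
  ⇓-local (pair s t) = let k , f = Local-× (⇓-local s) (⇓-local t) in
    k , λ eq → let s′ , t′ = f eq in pair s′ t′
  ⇓-local (comp s t) = let k , f = Local-× (⇓-local s) (⇓-local t) in
    k , λ eq → let s′ , t′ = f eq in comp s′ t′
  ⇓-local (prec s) = let k , f = Iterate-local s in k , λ eq → prec (f eq)
  ⇓-local (mu {e = e} {n = n} {m = m} s t) =
    let k , f = Local-× (⇓-local s)
                  (Local-∀< {P = λ j q → ∃[ i ] q ⊢ e · n ∙ j ⇓ suc i} m λ j<m →
                    let i , r = t j<m
                        k , f = ⇓-local r
                    in k , λ eq → i , f eq)
    in k , λ eq → let s′ , t′ = f eq in mu s′ t′

  Iterate-local : Iterate p d e n k m → Local p (λ q → Iterate q d e n k m)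
  Iterate-local (base s)   = let k , f = ⇓-local s in k , λ eq → base (f eq)
  Iterate-local (step s t) = let k , f = Local-× (Iterate-local s) (⇓-local t) in
    k , λ eq → let s′ , t′ = f eq in step s′ t′

-- The length cannot be read off the code: `0 ∙ 0` is `0`, so all prefixes of the zero sequence have
-- code `0`. Hence the explicit `k` in `prefix-injective` and in `question`.
prefix : Baire → Baire
prefix p zero    = 0
prefix p (suc k) = p k ∙ prefix p k

prefix-injective : ∀ k → prefix p k ≡ prefix q k → p ≗[ k ] q
prefix-injective (suc k) eq i<1+k with ∙-injective eq | m<1+n⇒m<n∨m≡n i<1+k
... | _ , eq′ | inj₁ i<k  = prefix-injective k eq′ i<k
... | eq′ , _ | inj₂ refl = eq′

-- Programming

infix 4 _⊢_↓_
_⊢_↓_ : Baire → Code → Baire → Set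
p ⊢ e ↓ q = ∀ n → p ⊢ e · n ⇓ q n

⇓-fst-∙ : ∀ m n → p ⊢ fst · m ∙ n ⇓ m
⇓-fst-∙ m n = subst (_ ⊢ fst · m ∙ n ⇓_) (cong proj₁ (unpair-∙ m n)) fst

⇓-snd-∙ : ∀ m n → p ⊢ snd · m ∙ n ⇓ n
⇓-snd-∙ m n = subst (_ ⊢ snd · m ∙ n ⇓_) (cong proj₂ (unpair-∙ m n)) snd

∙-unpair : ∀ n → π₁ n ∙ π₂ n ≡ n
∙-unpair zero    = refl
∙-unpair (suc n) = trans (∙-next (unpair n)) (cong suc (∙-unpair n))
  where
  ∙-next : ∀ x → proj₁ (next x) ∙ proj₂ (next x) ≡ suc (proj₁ x ∙ proj₂ x)
  ∙-next (zero  , n) rewrite +-identityʳ n = +-identityʳ _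
  ∙-next (suc m , n) rewrite +-suc m n = +-suc _ n

identity : Code
identity = pair fst snd

⇓-identity : p ⊢ identity · n ⇓ n
⇓-identity {n = n} = subst (_ ⊢ identity · n ⇓_) (∙-unpair n) (pair fst snd)

const : ℕ → Code
const zero    = zero
const (suc k) = comp succ (const k)

⇓-const : ∀ k → p ⊢ const k · n ⇓ k
⇓-const zero    = zero
⇓-const (suc k) = comp (⇓-const k) succ

-- A recursion on the value of `c` whose step always returns the second branch. Both branches are
-- evaluated beforehand, so both must halt.
ifZero : Code → Code → Code → Code
ifZero c d e = comp (prec fst (comp snd fst)) (pair (pair d e) c)

ifZero-value : ℕ → ℕ → ℕ → ℕ
ifZero-value zero    m n = m
ifZero-value (suc _) m n = n

⇓-prec-∙ : ∀ {x} → Iterate p d e x k m → p ⊢ prec d e · x ∙ k ⇓ m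
⇓-prec-∙ {p} {d} {e} {k} {m} {x} s = prec
  (subst (λ (x , k) → Iterate p d e x k m) (sym (unpair-∙ x k)) s)

⇓-ifZero : ∀ {c} → p ⊢ c · n ⇓ i → p ⊢ d · n ⇓ j → p ⊢ e · n ⇓ k →
           p ⊢ ifZero c d e · n ⇓ ifZero-value i j k
⇓-ifZero {p} {i = i} {j = j} {k = k} r s t = comp (pair (pair s t) r) (⇓-prec-∙ (go i))
  where
  go : ∀ i → Iterate p fst (comp snd fst) (j ∙ k) i (ifZero-value i j k)
  go zero    = base (⇓-fst-∙ j k)
  go (suc i) = step (go i) (comp (⇓-fst-∙ (j ∙ k) _) (⇓-snd-∙ j k))

natrec : Code → Code → Code → Code
natrec d e c = comp (prec d (comp e snd)) (pair zero c)

⇓-natrec : ∀ {c} (r : Baire) → p ⊢ d · 0 ⇓ r 0 →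
           (∀ k → p ⊢ e · k ∙ r k ⇓ r (suc k)) →
           p ⊢ c · n ⇓ k → p ⊢ natrec d e c · n ⇓ r k
⇓-natrec {p} {d = d} {e = e} {k = k} r z s t = comp (pair zero t) (⇓-prec-∙ (go k))
  where
  go : ∀ k → Iterate p d (comp e snd) 0 k (r k)
  go zero    = base z
  go (suc k) = step (go k) (comp (⇓-snd-∙ 0 _) (s k))

infix 8 _[_]
_[_] : Code → Code → Code
zero     [ c ] = zero
succ     [ c ] = succ
fst      [ c ] = fst
snd      [ c ] = snd
oracle   [ c ] = c
pair d e [ c ] = pair (d [ c ]) (e [ c ])
comp d e [ c ] = comp (d [ c ]) (e [ c ])
prec d e [ c ] = prec (d [ c ]) (e [ c ])
mu e     [ c ] = mu (e [ c ])

mutual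
  ⇓-[] : ∀ {c} → p ⊢ c ↓ q → q ⊢ e · n ⇓ m → p ⊢ e [ c ] · n ⇓ m
  ⇓-[] h zero       = zero
  ⇓-[] h succ       = succ
  ⇓-[] h fst        = fst
  ⇓-[] h snd        = snd
  ⇓-[] h oracle     = h _
  ⇓-[] h (pair s t) = pair (⇓-[] h s) (⇓-[] h t)
  ⇓-[] h (comp s t) = comp (⇓-[] h s) (⇓-[] h t)
  ⇓-[] h (prec s)   = prec (Iterate-[] h s)
  ⇓-[] h (mu s t)   = mu (⇓-[] h s) λ j<m → let i , r = t j<m in i , ⇓-[] h r

  Iterate-[] : ∀ {c} → p ⊢ c ↓ q → Iterate q d e n k m →
               Iterate p (d [ c ]) (e [ c ]) n k m
  Iterate-[] h (base s)   = base (⇓-[] h s)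
  Iterate-[] h (step s t) = step (Iterate-[] h s) (⇓-[] h t)

cons : ℕ → Baire → Baire
cons x p zero    = x
cons x p (suc n) = p n

consCode : ℕ → Code → Code
consCode x e = natrec (const x) (comp e fst) identity

↓-cons : ∀ x → p ⊢ e ↓ q → p ⊢ consCode x e ↓ cons x q
↓-cons {q = q} x h n =
  ⇓-natrec (cons x q) (⇓-const x) (λ k → comp (⇓-fst-∙ k _) (h k)) ⇓-identity

-- The n-th entry of ⟨ p , q ⟩ is the entry of p or q at index ⌊n/2⌋; a cursor
-- is the parity of n together with that index.

advance : ℕ × ℕ → ℕ × ℕ
advance (zero  , i) = 1 , i
advance (suc _ , i) = 0 , suc i

cursor : ℕ → ℕ × ℕ
cursor zero    = 0 , 0
cursor (suc n) = advance (cursor n)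

entry : Baire → Baire → ℕ × ℕ → ℕ
entry p q (par , i) = ifZero-value par (p i) (q i)

-- Dropping the first entry of `⟨ p , q ⟩` leaves `⟨ q , tail p ⟩`. Advancing the cursor matches
-- this swap, so the induction lets `p` and `q` vary.
entry-cursor : ∀ p q n → entry p q (cursor n) ≡ ⟨ p , q ⟩ n
entry-cursor p q zero    = refl
entry-cursor p q (suc n) =
  trans (entry-advance (cursor n)) (entry-cursor q (tail p) n)
  where
  entry-advance : ∀ c → entry p q (advance c) ≡ entry q (tail p) c
  entry-advance (zero  , i) = refl
  entry-advance (suc _ , i) = refl

advanceCode cursorCode : Code
advanceCode = ifZero (comp fst snd)
  (pair (const 1) (comp snd snd))
  (pair zero (comp succ (comp snd snd)))
cursorCode = natrec zero advanceCode identity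

⇓-cursor : p ⊢ cursorCode · n ⇓ proj₁ (cursor n) ∙ proj₂ (cursor n)
⇓-cursor {p} = ⇓-natrec (λ n → proj₁ (cursor n) ∙ proj₂ (cursor n)) zero
                        (λ k → ⇓-advance k (cursor k)) ⇓-identity
  where
  advance-∙ : ∀ ((par , i) : ℕ × ℕ) → ifZero-value par (1 ∙ i) (0 ∙ suc i) ≡
              proj₁ (advance (par , i)) ∙ proj₂ (advance (par , i))
  advance-∙ (zero  , i) = refl
  advance-∙ (suc _ , i) = refl

  ⇓-advance : ∀ k ((par , i) : ℕ × ℕ) → p ⊢ advanceCode · k ∙ (par ∙ i) ⇓
              proj₁ (advance (par , i)) ∙ proj₂ (advance (par , i))
  ⇓-advance k (par , i) = subst (p ⊢ advanceCode · k ∙ (par ∙ i) ⇓_) (advance-∙ (par , i))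
    (⇓-ifZero (comp (⇓-snd-∙ k _) (⇓-fst-∙ par i))
              (pair (⇓-const 1) index)
              (pair zero (comp index succ)))
    where
    index : p ⊢ comp snd snd · k ∙ (par ∙ i) ⇓ i
    index = comp (⇓-snd-∙ k _) (⇓-snd-∙ par i)

interleave : Code → Code → Code
interleave d e = comp (ifZero fst (comp d snd) (comp e snd)) cursorCode

↓-interleave : ∀ {r s} → p ⊢ d ↓ r → p ⊢ e ↓ s → p ⊢ interleave d e ↓ ⟨ r , s ⟩
↓-interleave {p} {d} {e} {r} {s} f g n =
  subst (p ⊢ interleave d e · n ⇓_) (entry-cursor r s n) (comp ⇓-cursor (select (cursor n)))
  where
  select : ∀ ((par , i) : ℕ × ℕ) →
           p ⊢ ifZero fst (comp d snd) (comp e snd) · par ∙ i ⇓ entry r s (par , i)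
  select (par , i) = ⇓-ifZero (⇓-fst-∙ par i) (comp (⇓-snd-∙ par i) (f i))
                                              (comp (⇓-snd-∙ par i) (g i))

prefixCode : Code → Code
prefixCode = natrec zero (pair (comp oracle fst) snd)

⇓-prefix : ∀ {c} → p ⊢ c · n ⇓ k → p ⊢ prefixCode c · n ⇓ prefix p k
⇓-prefix {p} = ⇓-natrec (prefix p) zero λ k → pair (comp (⇓-fst-∙ k _) oracle) (⇓-snd-∙ k _)

-- Self-evaluation

question : Baire → ℕ → ℕ → ℕ → ℕ
question p n m k = n ∙ (m ∙ (k ∙ prefix p k))

questionCode : Code
questionCode =
  pair fst (pair (comp fst snd) (pair (comp snd snd) (prefixCode (comp snd snd))))

⇓-question : ∀ n j → p ⊢ questionCode · n ∙ j ⇓ question p n (π₁ j) (π₂ j)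
⇓-question n j = pair (⇓-fst-∙ n j) (pair (comp (⇓-snd-∙ n j) fst)
  (pair (comp (⇓-snd-∙ n j) snd) (⇓-prefix (comp (⇓-snd-∙ n j) snd))))

-- The search variable codes a candidate output and a prefix length. The table bit is inverted
-- because `mu` looks for a zero. The program to be evaluated enters only through the oracle.
selfEval : Code
selfEval = comp fst (mu (ifZero (comp oracle questionCode) (const 1) zero))

least-zero : ∀ (t : Baire) j → t j ≡ 0 →
             ∃[ m ] t m ≡ 0 × (∀ {i} → i < m → ∃[ k ] t i ≡ suc k)
least-zero t j tj≡0 with t 0 in t0
... | zero = 0 , t0 , λ ()
least-zero t zero    tj≡0 | suc k with () ← trans (sym t0) tj≡0
least-zero t (suc j) tj≡0 | suc k =
  let m , tm≡0 , below = least-zero (tail t) j tj≡0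
  in suc m , tm≡0 , λ { {zero} _ → k , t0 ; {suc i} i<m → below (s<s⁻¹ i<m) }

module _ (em : ExcludedMiddle 0ℓ) (d : Code) where

  -- The oracles p with x ≡ question p n m k are those sharing a prefix of length k.
  Forced : Pred ℕ 0ℓ
  Forced x = ∀ p n m k → x ≡ question p n m k → p ⊢ d · n ⇓ m

  -- `Forced` speaks of all oracles rather than of the one defined here, so this table can itself
  -- serve as the oracle of `d` without circularity.
  table : ℕ → Bool
  table x = does (em {Forced x})

  private
    w : Baire
    w = bit ∘ table

    negate : ℕ → ℕ
    negate i = ifZero-value i 1 0

  table-sound : ∀ n m k → negate (w (question w n m k)) ≡ 0 → w ⊢ d · n ⇓ m
  table-sound n m k eq with em {Forced (question w n m k)}
  -- `w` itself has the prefix asked about.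
  ... | yes forced = forced w n m k refl
  ... | no _ with () ← eq

  table-forced : ∀ {x} → Forced x → negate (w x) ≡ 0
  table-forced {x} forced with em {Forced x}
  ... | yes _       = refl
  ... | no ¬forced = contradiction forced ¬forced

  -- The computation uses a finite prefix of `w`, whose length serves as `k`: all oracles sharing
  -- that prefix give the same output.
  table-complete : w ⊢ d · n ⇓ m → ∃[ k ] negate (w (question w n m k)) ≡ 0
  table-complete {n} {m} s = let k , local = ⇓-local s in
    k , table-forced λ p n′ m′ k′ eq → forced k local p n′ m′ k′ eq
    where
    forced : ∀ k → (∀ {q} → w ≗[ k ] q → q ⊢ d · n ⇓ m) → Forced (question w n m k)
    forced k local p n′ m′ k′ eq with ∙-injective {n} {_} {n′} eq
    ... | refl , eq′ with ∙-injective {m} {_} {m′} eq′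
    ... | refl , eq″ with ∙-injective {k} {_} {k′} eq″
    ... | refl , prefix≡ = local (prefix-injective k prefix≡)

  ↓-selfEval : w ⊢ d ↓ q → w ⊢ selfEval ↓ q
  ↓-selfEval {q} h n =
    let k , found = table-complete (h n)
        j , zero-j , below = least-zero test (q n ∙ k)
          (subst (λ (m , k) → negate (w (question w n m k)) ≡ 0)
                 (sym (unpair-∙ (q n) k)) found)
    in subst (w ⊢ selfEval · n ⇓_)
         -- The least hit may involve another prefix length, but by soundness its output is again
         -- one of `d` on `w`, hence `q n`.
         (⇓-functional (λ _ → refl) (table-sound n (π₁ j) (π₂ j) zero-j) (h n))
         (comp (mu (subst (w ⊢ _ · n ∙ j ⇓_) zero-j (⇓-test j))
                   λ {i} i<j → let l , eq = below i<j in
                     l , subst (w ⊢ _ · n ∙ i ⇓_) eq (⇓-test i))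
               fst)
    where
    test : Baire
    test j = negate (w (question w n (π₁ j) (π₂ j)))

    ⇓-test : ∀ j → w ⊢ ifZero (comp oracle questionCode) (const 1) zero · n ∙ j ⇓ test j
    ⇓-test j = ⇓-ifZero (comp (⇓-question n j) oracle) (⇓-const 1) zero

open RepresentedSpace using (δ; δ-resp; δ-functional; δ-surjective)

private variable
  U V : RepresentedSpace 0ℓ

reflexive : ∀ {c} (X : RepresentedSpace c) {x} → RepresentedSpace._≈_ X x x
reflexive X = Setoid.refl (RepresentedSpace.setoid X)

-- A fixed point theorem in precomplete spaces

programmed : (X : RepresentedSpace 0ℓ) → Code → (2^ω ⇀ X)
programmed X e = record
  { graph = record
    { _at_    = λ b x → ∃[ q ] bit ∘ b ⊢ e ↓ q × x ∈ δ X q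
    ; at-resp = λ b≗ x≈ (q , h , x∈) →
        q , (λ n → ⇓-resp (cong bit ∘ b≗) (h n)) , δ-resp X (λ _ → refl) x≈ x∈
    }
  ; functional = λ (q , h , x∈) (q′ , h′ , x′∈) →
      δ-functional X
        (δ-resp X (λ n → ⇓-functional (λ _ → refl) (h n) (h′ n))
                  (reflexive X) x∈)
        x′∈
  }

programmed-computable : (X : RepresentedSpace 0ℓ) (e : Code) →
                        Computable (graph (programmed X e))
programmed-computable X e = e , λ p≗ (x , q , h , x∈) →
  q , (λ n → ⇓-resp (λ i → sym (p≗ i)) (h n)) , x , x∈ , q , h , x∈

-- `selfEval` does not depend on `e`, so `e` may contain it. A realizer `d` of the total extension
-- is chosen after `e`, and `b` is the table of `d`. On `b`, `selfEval` recovers the name that `d`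
-- yields, and the extension property ties to it whatever point `e` names there.
fixed-point : ExcludedMiddle 0ℓ → (X : RepresentedSpace 0ℓ) → Precomplete X →
  (e : Code) → ∃[ b ] ∃[ p ] b ⊢ selfEval ↓ p × ∃[ x ] x ∈ δ X p ×
    (∀ {q y} → b ⊢ e ↓ q → y ∈ δ X q → RepresentedSpace._≈_ X y x)
fixed-point em X precomplete e =
  let h′ , total , (d , realizes) , extends =
        precomplete (programmed X e) (programmed-computable X e)
      b = table em d
      p , d↓p , x , x∈ , x∈h′ = realizes (λ _ → refl) (total b)
  in bit ∘ b , p , ↓-selfEval em d d↓p , x , x∈ ,
     λ e↓q y∈ → _⇀_.functional h′ (extends b (_ , e↓q , y∈)) x∈h′

-- Realizers and reductions

module _ (em : ExcludedMiddle 0ℓ) (ext : Extensionality 0ℓ 0ℓ) where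

  Named : (U : RepresentedSpace 0ℓ) → Pred Baire 0ℓ
  Named U r = ∃[ u ] u ∈ δ U r

  valueIf : {P : Set} → Dec P → (P → Baire) → Pred Baire 0ℓ
  valueIf (yes w) s t = s w ≗ t
  valueIf (no _)  s t = ⊥

  -- Undefined off the names of U, so that any answer at r shows that r is a name.
  restrict : (U : RepresentedSpace 0ℓ) → (∀ r → Named U r → Baire) → (ℕᴺ ⇀ ℕᴺ)
  restrict U s = record
    { graph = record
      { _at_    = λ r → valueIf (em {Named U r}) (s r)
      ; at-resp = resp
      }
    ; functional = λ {r} → functional em (s r)
    }
    where
    resp : ∀ {r r′ t t′} → r ≗ r′ → t ≗ t′ →
           t ∈ valueIf (em {Named U r}) (s r) → t′ ∈ valueIf (em {Named U r′}) (s r′)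
    -- The choice `s` need not respect `≗`, so the two sequences are identified outright.
    resp {r} r≗ t≗ h with refl ← ext r≗ with em {Named U r}
    ... | yes _ = λ n → trans (h n) (t≗ n)

    functional : ∀ {P : Set} (dec : Dec P) (s : P → Baire) {t t′} →
                 t ∈ valueIf dec s → t′ ∈ valueIf dec s → t ≗ t′
    functional (yes _) s h h′ n = trans (sym (h n)) (h′ n)

  restrict-named : ∀ {s r t} → t ∈ graph (restrict U s) at r → Named U r
  restrict-named {U} {r = r} h with em {Named U r}
  ... | yes w = w

  restrict-⊩ : (g : U ⇉ V) (s : ∀ r → Named U r → Baire) →
    (∀ r ((u , u∈) : Named U r) → ∃[ v ] v ∈ δ V (s r (u , u∈)) × v ∈ g at u) →
    restrict U s ⊩ g
  restrict-⊩ {U} {V} g s good {r} {u} u∈ _ with em {Named U r}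
  ... | no ¬named = contradiction (u , u∈) ¬named
  ... | yes (u′ , u′∈) =
    let v , v∈ , v∈g = good r (u′ , u′∈)
    in s r (u′ , u′∈) , (λ _ → refl) , v , v∈ ,
       _⇉_.at-resp g (δ-functional U u′∈ u∈) (reflexive V) v∈g

  answer : (g : U ⇉ V) → Total g → ∀ r → Named U r → Baire
  answer {V = V} g total r (u , _) = proj₁ (δ-surjective V (proj₁ (total u)))

  answer-good : (g : U ⇉ V) (total : Total g) → ∀ r ((u , u∈) : Named U r) →
                ∃[ v ] v ∈ δ V (answer g total r (u , u∈)) × v ∈ g at u
  answer-good {V = V} g total r (u , _) = let v , v∈g = total u in
    v , proj₂ (δ-surjective V v) , v∈g

  -- `answer` is overridden on the sequences pointwise equal to `r₀`. These name only points
  -- equivalent to `u₀`, so `v₀` stays a correct answer.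
  realizer-through : (g : U ⇉ V) → Total g → ∀ {r u q v} →
    u ∈ δ U r → v ∈ δ V q → v ∈ g at u →
    Σ[ G ∈ (ℕᴺ ⇀ ℕᴺ) ] G ⊩ g × q ∈ graph G at r
  realizer-through {U} {V} g total {r₀} {u₀} {q₀} {v₀} u₀∈ v₀∈ v₀∈g =
    restrict U s , restrict-⊩ g s good , at-r₀
    where
    s : ∀ r → Named U r → Baire
    s r w with em {r ≗ r₀}
    ... | yes _ = q₀
    ... | no  _ = answer g total r w

    good : ∀ r ((u , u∈) : Named U r) → ∃[ v ] v ∈ δ V (s r (u , u∈)) × v ∈ g at u
    good r (u , u∈) with em {r ≗ r₀}
    ... | no  _  = answer-good g total r (u , u∈)
    ... | yes r≗ = v₀ , v₀∈ , _⇉_.at-resp g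
      (δ-functional U u₀∈ (δ-resp U r≗ (reflexive U) u∈))
      (reflexive V) v₀∈g

    at-r₀ : q₀ ∈ graph (restrict U s) at r₀
    at-r₀ with em {Named U r₀}
    ... | no ¬named = contradiction (u₀ , u₀∈) ¬named
    ... | yes w with em {r₀ ≗ r₀}
    ...   | yes _ = λ _ → refl
    ...   | no ¬r = contradiction (λ _ → refl) ¬r

  -- Consequences of a reduction at a name of a point

  module _ {X Y U V : RepresentedSpace 0ℓ} (f : X ⇉ Y)
           (g : U ⇉ V) (total-g : Total g) (H K : Code)
           (reduces : ∀ G → G ⊩ g → sandwich ⟦ K ⟧ G ⟦ H ⟧ ⊩ f)
           {p x} (x∈ : x ∈ δ X p) (x∈dom : x ∈ dom f) where

    -- A reduction constrains only the composite. Testing it on a realizer undefined off the names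
    -- of `U` shows that `H` outputs a name.
    H-named : ∃[ r ] p ⊢ H ↓ r × Named U r
    H-named =
      let _ , (r , s , Hr , Gs , _) , _ =
            reduces (restrict U (answer g total-g))
                    (restrict-⊩ g (answer g total-g) (answer-good g total-g)) x∈ x∈dom
      in r , Hr , restrict-named {U = U} {s = answer g total-g} {r = r} Gs

    K-answers : ∀ {r u q v} → p ⊢ H ↓ r → u ∈ δ U r → v ∈ δ V q → v ∈ g at u →
                ∃[ t ] ⟨ p , q ⟩ ⊢ K ↓ t × ∃[ y ] y ∈ δ Y t × y ∈ f at x
    K-answers {r} {q = q} Hr u∈ v∈ v∈g =
      let G , G⊩g , Gq = realizer-through g total-g u∈ v∈ v∈g
          t , (r′ , s , Hr′ , Gs , Kt) , y , y∈ , y∈f = reduces G G⊩g x∈ x∈dom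
          -- The reduction brings its own intermediate sequences; single-valuedness of `H` and `G`
          -- identifies them with `r` and `q`.
          r′≗r : r′ ≗ r
          r′≗r n = ⇓-functional (λ _ → refl) (Hr′ n) (Hr n)
          s≗q = _⇀_.functional G (_⇉_.at-resp (graph G) r′≗r (λ _ → refl) Gs) Gq
      in t , (λ n → ⇓-resp (⟨⟩-cong (λ _ → refl) s≗q) (Kt n)) , y , y∈ , y∈f

    -- By the definition of `η`, `cons (gödel K) p` codes the map taking `q` to the output of `K` on
    -- `⟨ p , q ⟩`. Lying in the domain concerns every name of `v`, and `K-answers` covers each.
    induced-⊆ : ∀ {r u v} → p ⊢ H ↓ r → u ∈ δ U r → v ∈ g at u →
      let k = induced V Y (η (cons (gödel K) p)) in
      v ∈ dom k × k at v ⊆ f at x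
    induced-⊆ {v = v} Hr u∈ v∈g =
      let q , v∈ = δ-surjective V v
          t , Kt , y , y∈ , _ = K-answers Hr u∈ v∈ v∈g
      in ( y
         , (λ q v∈ → let t , Kt , y , y∈ , _ = K-answers Hr u∈ v∈ v∈g in
              t , (K , refl , Kt) , y , y∈)
         , q , v∈ , t , (K , refl , Kt) , y∈ )
       , λ {y} (_ , q , v∈ , t , ηt , y∈) →
           -- The value `y` arises from a name `q` of `v`; at the same `q` the reduction gives a
           -- value in `f at x`, and the two agree.
           let t′ , Kt′ , y′ , y′∈ , y′∈f = K-answers Hr u∈ v∈ v∈g
               t′≗t = _⇀_.functional (η (cons (gödel K) p)) {q} (K , refl , Kt′) ηt
           in _⇉_.at-resp f (reflexive X)
                (δ-functional Y
                  (δ-resp Y t′≗t (reflexive Y) y′∈) y∈)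
                y′∈f

theorem11 :
  ExcludedMiddle 0ℓ → Extensionality 0ℓ 0ℓ →
  (X Y U V : RepresentedSpace 0ℓ) →
  TotalRepresentation X → Precomplete X →
  (f : X ⇉ Y) (g : U ⇉ V) → Total f → Total g →
  (Σ[ e ∈ (U ×ʳ 𝓜 V Y ⇉ X) ] Total e × Computable e ×
    (∀ {u k x v} → x ∈ e at (u , k) → v ∈ g at u →
      ¬ (v ∈ dom (proj₁ k) × proj₁ k at v ⊆ f at x))) →
  ¬ (f ≤W g)
theorem11 em ext X Y U V total-δ precomplete f g total-f total-g
          (e , total-e , (E , E⊩e) , avoids) (H , K , reduces) =
  -- With `p` the output of `selfEval`, this runs `E` on the pair of the output of `H` on `p` and
  -- the code of `K` with parameter `p`.
  let E∘⟨H,cK⟩ = E [ interleave (H [ selfEval ]) (consCode (gödel K) selfEval) ]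
      b , p , eval , x , x∈ , fixed = fixed-point em X precomplete E∘⟨H,cK⟩
      -- The point `x` is available before `E` is known to halt. As `f` is total, `H` then yields a
      -- name on `p`, which gives `E` a valid input.
      r , Hr , u , u∈ = H-named em ext f g total-g H K reduces x∈ (total-f x)
      c = cons (gödel K) p
      k = induced V Y (η c) , c , λ _ → ≐-refl
      q , Eq , y , y∈ , y∈e =
        E⊩e (r , c , (λ _ → refl) , u∈ , λ _ → ≐-refl) (total-e (u , k))
      v , v∈g = total-g u
      -- `E` on `⟨ r , c ⟩` gives the output of the composed program on `b`, so the fixed point
      -- property applies to `y`.
      y≈x = fixed (λ n → ⇓-[] (↓-interleave (λ m → ⇓-[] eval (Hr m))
                                            (↓-cons (gödel K) eval)) (Eq n))
                  y∈
      x∈e = _⇉_.at-resp e {u , k} (reflexive (U ×ʳ 𝓜 V Y) {u , k})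
                        y≈x y∈e
  in avoids {u} {k} x∈e v∈g
       (induced-⊆ em ext f g total-g H K reduces x∈ (total-f x) Hr u∈ v∈g)
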